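{- Let $E=(E^+,E^-)$ be a collection of labeled ABox examples with $E^+\neq\emptyset$, and let $\mathcal{L}\in\{\mathcal{EL}_\bot,\mathcal{ELI}_\bot\}$. Let $\mathcal{A}^+=\biguplus E^+$ be the (disjoint) union of all ABoxes in $E^+$. Then the following are equivalent: 1. there is an $\mathcal{L}$-ontology $\mathcal{O}$ that fits $E$, i.e. every $\mathcal{A}\in E^+$ is consistent with $\mathcal{O}$ and every $\mathcal{A}\in E^-$ is inconsistent with $\mathcal{O}$; 2. for every $\mathcal{A}\in E^-$, there is no $\mathcal{L}$-simulation from $\mathcal{A}$ to $\mathcal{A}^+$.
   Context: Let $\mathsf{N_C},\mathsf{N_R},\mathsf{N_I}$ be countably infinite sets of concept names, role names and individual names. A role is a role name $r$ or an inverse role $r^-$. $\mathcal{ELI}_\bot$-concepts are built by $C,D::=\top\mid\bot\mid A\mid C\sqcap D\mid\exists r.C$ with $A\in\mathsf{N_C}$ and $r$ a role; $\mathcal{EL}_\bot$-concepts are those without inverse roles. An $\mathcal{L}$-ontology is a finite set of concept inclusions (CIs) $C\sqsubseteq D$ with $C,D$ $\mathcal{L}$-concepts. An ABox is a finite nonempty set of assertions $A(a)$, $r(a,b)$ with $A\in\mathsf{N_C}$, $r\in\mathsf{N_R}$, $a,b\in\mathsf{N_I}$; $\mathsf{ind}(\mathcal{A})$ is the set of individual names in $\mathcal{A}$. Interpretations $\mathcal{I}=(\Delta^{\mathcal I},\cdot^{\mathcal I})$ have non-empty domain and the usual description-logic semantics. $\mathcal{I}$ satisfies $C\sqsubseteq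 D$ if $C^{\mathcal I}\subseteq D^{\mathcal I}$, $A(a)$ if $a\in A^{\mathcal I}$, and $r(a,b)$ if $(a,b)\in r^{\mathcal I}$ (standard names: individuals denote themselves). A model of an ontology or ABox satisfies all its members. $\mathcal{A}$ is consistent with $\mathcal{O}$ if $\mathcal{A}$ and $\mathcal{O}$ have a common model. An $\mathcal{EL}$-simulation from $\mathcal{I}_1$ to $\mathcal{I}_2$ is a relation $S\subseteq\Delta^{\mathcal{I}_1}\times\Delta^{\mathcal{I}_2}$ such that for all $(d_1,d_2)\in S$, $A\in\mathsf{N_C}$, $r\in\mathsf{N_R}$: (Atom) $d_1\in A^{\mathcal{I}_1}$ implies $d_2\in A^{\mathcal{I}_2}$; (Rel) if $(d_1,e_1)\in r^{\mathcal{I}_1}$, there is $e_2$ with $(d_2,e_2)\in r^{\mathcal{I}_2}$ and $(e_1,e_2)\in S$. An $\mathcal{ELI}$-simulation additionally satisfies (iRel): if $(e_1,d_1)\in r^{\mathcal{I}_1}$, there is $e_2$ with $(e_2,d_2)\in r^{\mathcal{I}_2}$ and $(e_1,e_2)\in S$. An $\mathcal{EL}_\bot$- (resp. $\mathcal{ELI}_\bot$-)simulation is an $\mathcal{EL}$- (resp. $\mathcal{ELI}$-)simulation that is moreover left-total: every $d_1\in\Delta^{\mathcal{I}_1}$ occurs as first component of a pair in $S$. An ABox $\mathcal{A}$ is viewed as the interpretation with domain $\mathsf{ind}(\mathcal{A})$, $A^{\mathcal A}=\{a\mid A(a)\in\mathcal{A}\}$, $r^{\mathcal A}=\{(a,b)\mid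 r(a,b)\in\mathcal{A}\}$. A collection of labeled ABox examples is a pair $E=(E^+,E^-)$ of finite sets of ABoxes; the ABoxes in $E$ are assumed to have pairwise disjoint sets of individual names. -}

module Defs where

open import Data.Empty using (⊥; ⊥-elim)
open import Data.List using (List; []; _∷_; _++_; concatMap)
open import Data.List.Membership.Propositional using (_∈_; lose)
open import Data.List.Membership.Propositional.Properties using (∈-concatMap⁺)
open import Data.List.NonEmpty as List⁺ using (List⁺; _∷_)
open import Data.List.Relation.Binary.BagAndSetEquality using (_∼[_]_; set)
open import Data.List.Relation.Binary.Disjoint.Propositional using (Disjoint)
open import Data.List.Relation.Unary.All using (All)
open import Data.List.Relation.Unary.Any using (here; there)
open import Data.Nat using (ℕ)
open import Data.Product using (∃-syntax; _×_; _,_)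
open import Data.Sum using (_⊎_; inj₁; inj₂)
open import Function using (_↔_)
open import Level using (0ℓ)
open import Relation.Binary using (Rel; REL)
open import Relation.Binary.PropositionalEquality using (_≡_; _≢_; refl)
open import Relation.Nullary using (¬_)
import Relation.Unary as U
open U using (Pred)

record Signature : Set₁ where
  field
    NC NR NI : Set
    NC↔ℕ : NC ↔ ℕ
    NR↔ℕ : NR ↔ ℕ
    NI↔ℕ : NI ↔ ℕ

data Language : Set where
  EL⊥ ELI⊥ : Language

module DL (sig : Signature) where
  open Signature sig

  data Role : Language → Set where
    name : ∀ {ℒ} → NR → Role ℒ
    inv  : NR → Role ELI⊥

  infixr 6 _⊓_
  infix  7 ∃[_]∙_
  infix  4 _⊑_

  data Concept (ℒ : Language) : Set where
    ⊤ᶜ ⊥ᶜ  : Concept ℒ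
    atom   : NC → Concept ℒ
    _⊓_    : Concept ℒ → Concept ℒ → Concept ℒ
    ∃[_]∙_ : Role ℒ → Concept ℒ → Concept ℒ

  data CI (ℒ : Language) : Set where
    _⊑_ : Concept ℒ → Concept ℒ → CI ℒ

  -- Finite sets (of inclusions, assertions, ABoxes) are given by lists; order
  -- and repetitions play no role in any of the notions below.
  Ontology : Language → Set
  Ontology ℒ = List (CI ℒ)

  data Assertion : Set where
    concept : NC → NI → Assertion
    role    : NR → NI → NI → Assertion

  ABox : Set
  ABox = List⁺ Assertion

  infix 4 _∈ᴬ_ _≈ᴬ_

  _∈ᴬ_ : Assertion → ABox → Set
  α ∈ᴬ 𝒜 = α ∈ List⁺.toList 𝒜

  _≈ᴬ_ : ABox → ABox → Set
  𝒜 ≈ᴬ ℬ = List⁺.toList 𝒜 ∼[ set ] List⁺.toList ℬ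

  indAssertion : Assertion → List NI
  indAssertion (concept A a) = a ∷ []
  indAssertion (role r a b)  = a ∷ b ∷ []

  ind : ABox → List NI
  ind 𝒜 = concatMap indAssertion (List⁺.toList 𝒜)

  -- Standard names: the domain is a set Δ whose members are individual names
  -- (denoting themselves) or other objects, so Δ is a subset of NI ⊎ Other.
  -- Not every individual name need belong to Δ.
  record Interpretation : Set₁ where
    field
      Other : Set

    Object : Set
    Object = NI ⊎ Other

    field
      Δ        : Pred Object 0ℓ
      nonempty : U.Satisfiable Δ
      conc     : NC → Pred Object 0ℓ
      rel      : NR → Rel Object 0ℓ
      conc⊆Δ   : ∀ {A d} → conc A d → Δ d
      rel⊆Δ×Δ  : ∀ {r d e} → rel r d e → Δ d × Δ e

  module Semantics (ℐ : Interpretation) where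
    open Interpretation ℐ

    roleExt : ∀ {ℒ} → Role ℒ → Rel Object 0ℓ
    roleExt (name r) d e = rel r d e
    roleExt (inv r)  d e = rel r e d

    ext : ∀ {ℒ} → Concept ℒ → Pred Object 0ℓ
    ext ⊤ᶜ            = Δ
    ext ⊥ᶜ            = U.∅
    ext (atom A)      = conc A
    ext (C ⊓ D)       = ext C U.∩ ext D
    ext (∃[ R ]∙ C) d = ∃[ e ] (roleExt R d e × ext C e)

    SatisfiesCI : ∀ {ℒ} → CI ℒ → Set
    SatisfiesCI (C ⊑ D) = ext C U.⊆ ext D

    SatisfiesAssertion : Assertion → Set
    SatisfiesAssertion (concept A a) = conc A (inj₁ a)
    SatisfiesAssertion (role r a b)  = rel r (inj₁ a) (inj₁ b)

    ModelOfOntology : ∀ {ℒ} → Ontology ℒ → Set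
    ModelOfOntology 𝒪 = All SatisfiesCI 𝒪

    ModelOfABox : ABox → Set
    ModelOfABox 𝒜 = All SatisfiesAssertion (List⁺.toList 𝒜)

  open Semantics public using (ModelOfOntology; ModelOfABox)

  Consistent : ∀ {ℒ} → ABox → Ontology ℒ → Set₁
  Consistent 𝒜 𝒪 = ∃[ ℐ ] (ModelOfABox ℐ 𝒜 × ModelOfOntology ℐ 𝒪)

  module _ (ℐ₁ ℐ₂ : Interpretation) where
    private
      module I₁ = Interpretation ℐ₁
      module I₂ = Interpretation ℐ₂

    record IsELSimulation (S : REL I₁.Object I₂.Object 0ℓ) : Set where
      field
        S⊆Δ×Δ    : ∀ {d₁ d₂} → S d₁ d₂ → I₁.Δ d₁ × I₂.Δ d₂
        atom-sim : ∀ {d₁ d₂ A} → S d₁ d₂ → I₁.conc A d₁ → I₂.conc A d₂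
        rel-sim  : ∀ {d₁ d₂ e₁ r} → S d₁ d₂ → I₁.rel r d₁ e₁ →
                   ∃[ e₂ ] (I₂.rel r d₂ e₂ × S e₁ e₂)

    record IsELISimulation (S : REL I₁.Object I₂.Object 0ℓ) : Set where
      field
        isELSimulation : IsELSimulation S
        irel-sim : ∀ {d₁ d₂ e₁ r} → S d₁ d₂ → I₁.rel r e₁ d₁ →
                   ∃[ e₂ ] (I₂.rel r e₂ d₂ × S e₁ e₂)

    LeftTotal : REL I₁.Object I₂.Object 0ℓ → Set
    LeftTotal S = ∀ {d₁} → I₁.Δ d₁ → ∃[ d₂ ] S d₁ d₂

    IsSimulation : Language → REL I₁.Object I₂.Object 0ℓ → Set
    IsSimulation EL⊥  S = IsELSimulation S × LeftTotal S
    IsSimulation ELI⊥ S = IsELISimulation S × LeftTotal S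

  Simulation : Language → Interpretation → Interpretation → Set₁
  Simulation ℒ ℐ₁ ℐ₂ = ∃[ S ] IsSimulation ℐ₁ ℐ₂ ℒ S

  ind-nonempty : ∀ 𝒜 → ∃[ a ] a ∈ ind 𝒜
  ind-nonempty (concept A a ∷ _) = a , here refl
  ind-nonempty (role r a b ∷ _)  = a , here refl

  ∈-ind : ∀ 𝒜 {α a} → α ∈ᴬ 𝒜 → a ∈ indAssertion α → a ∈ ind 𝒜
  ∈-ind 𝒜 α∈𝒜 a∈α = ∈-concatMap⁺ indAssertion (lose α∈𝒜 a∈α)

  ⟪_⟫ : ABox → Interpretation
  ⟪ 𝒜 ⟫ .Interpretation.Other = ⊥
  ⟪ 𝒜 ⟫ .Interpretation.Δ (inj₁ a) = a ∈ ind 𝒜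
  ⟪ 𝒜 ⟫ .Interpretation.nonempty =
    let (a , a∈𝒜) = ind-nonempty 𝒜 in inj₁ a , a∈𝒜
  ⟪ 𝒜 ⟫ .Interpretation.conc A (inj₁ a) = concept A a ∈ᴬ 𝒜
  ⟪ 𝒜 ⟫ .Interpretation.rel r (inj₁ a) (inj₁ b) = role r a b ∈ᴬ 𝒜
  ⟪ 𝒜 ⟫ .Interpretation.conc⊆Δ {d = inj₁ a} α∈𝒜 = ∈-ind 𝒜 α∈𝒜 (here refl)
  ⟪ 𝒜 ⟫ .Interpretation.rel⊆Δ×Δ {d = inj₁ a} {e = inj₁ b} α∈𝒜 =
    ∈-ind 𝒜 α∈𝒜 (here refl) , ∈-ind 𝒜 α∈𝒜 (there (here refl))

  -- ABoxes with the same assertions are one ABox, so the disjointness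
  -- assumption concerns only those that differ as sets.
  record LabeledExamples : Set where
    field
      E⁺ E⁻    : List ABox
      disjoint : ∀ {𝒜 ℬ} → 𝒜 ∈ E⁺ ++ E⁻ → ℬ ∈ E⁺ ++ E⁻ →
                 ¬ (𝒜 ≈ᴬ ℬ) → Disjoint (ind 𝒜) (ind ℬ)

  Fits : ∀ {ℒ} → Ontology ℒ → LabeledExamples → Set₁
  Fits 𝒪 E = (∀ {𝒜} → 𝒜 ∈ E⁺ → Consistent 𝒜 𝒪)
           × (∀ {𝒜} → 𝒜 ∈ E⁻ → ¬ Consistent 𝒜 𝒪)
    where open LabeledExamples E

  ⨄ : (𝒜s : List ABox) → 𝒜s ≢ [] → ABox
  ⨄ []       ≢[] = ⊥-elim (≢[] refl)
  ⨄ (𝒜 ∷ 𝒜s) _   = List⁺.concat (𝒜 ∷ 𝒜s)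

{-# OPTIONS --safe #-}
-- (1 ⇒ 2)  Let S be a simulation from 𝒜 ∈ E⁻ to 𝒜⁺. The disjoint union ℐ of
-- models of the positive examples is a model of 𝒪 into which 𝒜 is simulated.
-- Since concepts are preserved by products, an individual a that is simulated
-- by several elements of ℐ may be interpreted by the whole set {d | S a d}: the
-- nonempty subsets of ℐ form a model of 𝒪, in which a set belongs to a concept
-- iff all its members do. This makes 𝒜 consistent with 𝒪.
--
-- (2 ⇒ 1)  Refine a finite set of candidate pairs between 𝒜 and 𝒜⁺, keeping for
-- each discarded pair (a , b) a concept that holds at a but not at b. The
-- refinement ends in a simulation, which is not left-total; so some a is
-- separated from every b, and the conjunction C of the separating concepts is
-- satisfied in 𝒜 but empty in 𝒜⁺. The inclusions C ⊑ ⊥ fit E.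
module Submission where

open import Data.Empty using (⊥; ⊥-elim)
open import Data.List using (List; []; _∷_; concatMap; cartesianProduct; filter; length)
open import Data.List.Membership.Propositional using (_∈_; find; lose)
open import Data.List.Membership.Propositional.Properties
  using (∈-concatMap⁺; ∈-concatMap⁻; ∈-cartesianProduct⁺; ∈-filter⁺; ∈-++⁺ˡ)
import Data.List.Membership.DecPropositional as DecMembership
open import Data.List.NonEmpty as List⁺ using ()
open import Data.List.Properties using (filter-notAll)
open import Data.List.Relation.Unary.All as All using (All; []; _∷_)
open import Data.List.Relation.Unary.Any as Any using (here; there)
open import Data.Nat using (_<_)
open import Data.Nat.Induction using (<-wellFounded)
import Data.Nat.Properties as ℕ
open import Data.Product using (∃-syntax; Σ-syntax; _×_; _,_; proj₁; proj₂)
open import Data.Product.Properties using (≡-dec)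
open import Data.Sum as Sum using (_⊎_; inj₁; inj₂)
open import Function using (_⇔_; mk⇔; _∘_; Equivalence)
open import Function.Properties.Inverse using (↔⇒↣)
open import Induction.WellFounded using (Acc; acc)
open import Level using (0ℓ)
open import Relation.Binary using (REL; DecidableEquality)
open import Relation.Binary.PropositionalEquality using (_≡_; _≢_; refl)
open import Relation.Nullary using (¬_; yes; no; ¬?)
open import Relation.Nullary.Decidable using (via-injection; map′; decidable-stable; _×-dec_)
import Relation.Unary as U
open U using (Pred)
open import Defs

module Proof (sig : Signature) where
  open Signature sig
  open DL sig
  open Semantics using (ext; roleExt)
  open Interpretation

  -- Decidable equality of names and assertions.

  _≟C_ : DecidableEquality NC
  _≟C_ = via-injection (↔⇒↣ NC↔ℕ) ℕ._≟_

  _≟R_ : DecidableEquality NR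
  _≟R_ = via-injection (↔⇒↣ NR↔ℕ) ℕ._≟_

  _≟I_ : DecidableEquality NI
  _≟I_ = via-injection (↔⇒↣ NI↔ℕ) ℕ._≟_

  _≟ᴬ_ : DecidableEquality Assertion
  concept A a ≟ᴬ concept B b =
    map′ (λ { (refl , refl) → refl }) (λ { refl → refl , refl }) (A ≟C B ×-dec a ≟I b)
  concept _ _ ≟ᴬ role _ _ _  = no λ ()
  role _ _ _  ≟ᴬ concept _ _ = no λ ()
  role r a b  ≟ᴬ role s c d  =
    map′ (λ { (refl , refl , refl) → refl }) (λ { refl → refl , refl , refl })
         (r ≟R s ×-dec a ≟I c ×-dec b ≟I d)

  open DecMembership _≟I_ using () renaming (_∈?_ to _∈I?_)
  open DecMembership _≟ᴬ_ using () renaming (_∈?_ to _∈ᴬ?_)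

  -- Concept extensions, and simulations stated uniformly for both languages.

  ext⊆Δ : ∀ ℐ {ℒ} (C : Concept ℒ) {d} → ext ℐ C d → Δ ℐ d
  ext⊆Δ ℐ ⊤ᶜ               d∈Δ         = d∈Δ
  ext⊆Δ ℐ (atom A)         d∈A         = conc⊆Δ ℐ d∈A
  ext⊆Δ ℐ (C ⊓ D)          (d∈C , _)   = ext⊆Δ ℐ C d∈C
  ext⊆Δ ℐ (∃[ name r ]∙ C) (_ , p , _) = proj₁ (rel⊆Δ×Δ ℐ p)
  ext⊆Δ ℐ (∃[ inv r ]∙ C)  (_ , p , _) = proj₂ (rel⊆Δ×Δ ℐ p)

  -- Quantifying over `Role ℒ` merges (Rel) and (iRel): inverse roles exist only in `ELI⊥`, so later
  -- arguments need no separate treatment of the two languages.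
  record IsRoleSimulation (ℒ : Language) (ℐ₁ ℐ₂ : Interpretation)
                          (S : REL (Object ℐ₁) (Object ℐ₂) 0ℓ) : Set where
    field
      S⊆Δ×Δ    : ∀ {d₁ d₂} → S d₁ d₂ → Δ ℐ₁ d₁ × Δ ℐ₂ d₂
      atom-sim : ∀ {d₁ d₂ A} → S d₁ d₂ → conc ℐ₁ A d₁ → conc ℐ₂ A d₂
      role-sim : ∀ {d₁ d₂ e₁} (R : Role ℒ) → S d₁ d₂ → roleExt ℐ₁ R d₁ e₁ →
                 ∃[ e₂ ] (roleExt ℐ₂ R d₂ e₂ × S e₁ e₂)
      total    : LeftTotal ℐ₁ ℐ₂ S

  toRoleSimulation : ∀ ℒ {ℐ₁ ℐ₂ S} → IsSimulation ℐ₁ ℐ₂ ℒ S → IsRoleSimulation ℒ ℐ₁ ℐ₂ S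
  toRoleSimulation EL⊥ (sim , total) = record
    { S⊆Δ×Δ    = S⊆Δ×Δ
    ; atom-sim = atom-sim
    ; role-sim = λ { (name r) → rel-sim }
    ; total    = total
    } where open IsELSimulation sim
  toRoleSimulation ELI⊥ (sim , total) = record
    { S⊆Δ×Δ    = S⊆Δ×Δ
    ; atom-sim = atom-sim
    ; role-sim = λ { (name r) → rel-sim ; (inv r) → irel-sim }
    ; total    = total
    } where
      open IsELISimulation sim
      open IsELSimulation isELSimulation

  fromRoleSimulation : ∀ ℒ {ℐ₁ ℐ₂ S} → IsRoleSimulation ℒ ℐ₁ ℐ₂ S → IsSimulation ℐ₁ ℐ₂ ℒ S
  fromRoleSimulation EL⊥ sim = record
    { S⊆Δ×Δ    = S⊆Δ×Δ
    ; atom-sim = atom-sim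
    ; rel-sim  = role-sim (name _)
    } , total
    where open IsRoleSimulation sim
  fromRoleSimulation ELI⊥ sim = record
    { isELSimulation = record
      { S⊆Δ×Δ    = S⊆Δ×Δ
      ; atom-sim = atom-sim
      ; rel-sim  = role-sim (name _)
      }
    ; irel-sim = role-sim (inv _)
    } , total
    where open IsRoleSimulation sim

  -- ABoxes as interpretations, and their models.

  fact : ∀ {ℒ} → Role ℒ → NI → NI → Assertion
  fact (name r) a b = role r a b
  fact (inv r)  a b = role r b a

  fact-ind : ∀ {ℒ} (R : Role ℒ) a b →
             a ∈ indAssertion (fact R a b) × b ∈ indAssertion (fact R a b)
  fact-ind (name r) a b = here refl , there (here refl)
  fact-ind (inv r)  a b = there (here refl) , here refl

  fact⇒roleExt : ∀ {ℒ} 𝒜 (R : Role ℒ) {a b} →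
                 fact R a b ∈ᴬ 𝒜 → roleExt ⟪ 𝒜 ⟫ R (inj₁ a) (inj₁ b)
  fact⇒roleExt 𝒜 (name r) p = p
  fact⇒roleExt 𝒜 (inv r)  p = p

  roleExt⇒fact : ∀ {ℒ} 𝒜 (R : Role ℒ) {a b} →
                 roleExt ⟪ 𝒜 ⟫ R (inj₁ a) (inj₁ b) → fact R a b ∈ᴬ 𝒜
  roleExt⇒fact 𝒜 (name r) p = p
  roleExt⇒fact 𝒜 (inv r)  p = p

  ind⇒assertion : ∀ 𝒜 {a} → a ∈ ind 𝒜 → ∃[ α ] (α ∈ᴬ 𝒜 × a ∈ indAssertion α)
  ind⇒assertion 𝒜 = find ∘ ∈-concatMap⁻ indAssertion {xs = List⁺.toList 𝒜}

  module _ {𝒜 𝒥} (𝒥⊨𝒜 : ModelOfABox 𝒥 𝒜) where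

    ind⊆Δ : ∀ {a} → a ∈ ind 𝒜 → Δ 𝒥 (inj₁ a)
    ind⊆Δ a∈𝒜 with ind⇒assertion 𝒜 a∈𝒜
    ... | concept A a , α∈𝒜 , here refl         = conc⊆Δ 𝒥 (All.lookup 𝒥⊨𝒜 α∈𝒜)
    ... | role r a b  , α∈𝒜 , here refl         = proj₁ (rel⊆Δ×Δ 𝒥 (All.lookup 𝒥⊨𝒜 α∈𝒜))
    ... | role r a b  , α∈𝒜 , there (here refl) = proj₂ (rel⊆Δ×Δ 𝒥 (All.lookup 𝒥⊨𝒜 α∈𝒜))

    fact-model : ∀ {ℒ} (R : Role ℒ) {a b} →
                 fact R a b ∈ᴬ 𝒜 → roleExt 𝒥 R (inj₁ a) (inj₁ b)
    fact-model (name r) = All.lookup 𝒥⊨𝒜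
    fact-model (inv r)  = All.lookup 𝒥⊨𝒜

    -- Concepts are preserved under homomorphisms, and the identity on individuals is one from
    -- `⟪ 𝒜 ⟫` into any model of `𝒜`.
    ext-model : ∀ {ℒ} (C : Concept ℒ) {a} → ext ⟪ 𝒜 ⟫ C (inj₁ a) → ext 𝒥 C (inj₁ a)
    ext-model ⊤ᶜ       a∈𝒜       = ind⊆Δ a∈𝒜
    ext-model (atom A) A∈𝒜       = All.lookup 𝒥⊨𝒜 A∈𝒜
    ext-model (C ⊓ D)  (p , q)   = ext-model C p , ext-model D q
    ext-model (∃[ R ]∙ C) (inj₁ b , p , q) =
      inj₁ b , fact-model R (roleExt⇒fact 𝒜 R p) , ext-model C q

  -- The model of nonempty sets.

  data _InverseOf_ : ∀ {ℒ} → Role ℒ → NR → Set where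
    inverse : ∀ {r} → inv r InverseOf r

  module SetModel (ℐ : Interpretation) (ℒ : Language)
                  (base : NI → Pred (Object ℐ) 0ℓ)
                  (base⊆Δ : ∀ {a d} → base a d → Δ ℐ d)
                  (base-nonempty : ∃[ a ] U.Satisfiable (base a)) where

    -- All subsets of the domain would not fit into a Set, so a family of codes
    -- is used that contains the sets given by base and is closed under taking
    -- the R-successors in C of the elements of a member.
    data Code : Set where
      successors : NI ⊎ Code → Role ℒ → Concept ℒ → Code

    ⟦_⟧ : NI ⊎ Code → Pred (Object ℐ) 0ℓ
    ⟦ inj₁ a ⟧                    = base a
    ⟦ inj₂ (successors P R C) ⟧ e = ext ℐ C e × ∃[ d ] (⟦ P ⟧ d × roleExt ℐ R d e)

    ⟦_⟧⊆Δ : ∀ P {d} → ⟦ P ⟧ d → Δ ℐ d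
    ⟦ inj₁ a ⟧⊆Δ                   p       = base⊆Δ p
    ⟦ inj₂ (successors P R C) ⟧⊆Δ (p , _) = ext⊆Δ ℐ C p

    Step : Role ℒ → NI ⊎ Code → NI ⊎ Code → Set
    Step R P Q = ∀ {d} → ⟦ P ⟧ d → ∃[ e ] (roleExt ℐ R d e × ⟦ Q ⟧ e)

    Inhabited : Pred (NI ⊎ Code) 0ℓ
    Inhabited P = U.Satisfiable ⟦ P ⟧

    -- For `ELI⊥` the relation is the Egli-Milner lifting of `rel ℐ r` to nonempty sets. For `EL⊥`
    -- the type `R InverseOf r` is empty, so only the forward half remains; this matches what an
    -- `EL⊥`-simulation can provide.
    model : Interpretation
    model .Other     = Code
    model .Δ         = Inhabited
    model .nonempty  = inj₁ (proj₁ base-nonempty) , proj₂ base-nonempty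
    model .conc A P  = Inhabited P × ⟦ P ⟧ U.⊆ conc ℐ A
    model .rel r P Q = (Inhabited P × Inhabited Q) ×
                       Step (name r) P Q × (∀ {R} → R InverseOf r → Step R Q P)
    model .conc⊆Δ    = proj₁
    model .rel⊆Δ×Δ   = proj₁

    model-step : ∀ (R : Role ℒ) {P Q} → roleExt model R P Q → Step R P Q
    model-step (name r) (_ , step , _) = step
    model-step (inv r)  (_ , _ , back) = back inverse

    -- The hypothesis gives each member of `P` a successor in the new set; conversely, each member
    -- of the new set carries, by definition, the element of `P` it came from.
    model-successors : ∀ (R : Role ℒ) C {P} → Inhabited P → ⟦ P ⟧ U.⊆ ext ℐ (∃[ R ]∙ C) →
                       roleExt model R P (inj₂ (successors P R C))
    model-successors (name r) C (d , d∈P) P⊆ =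
      let (e , p , q) = P⊆ d∈P in
      ((d , d∈P) , (e , q , d , d∈P , p)) ,
      (λ d∈P → let (e , p , q) = P⊆ d∈P in e , p , q , _ , d∈P , p) ,
      (λ { inverse (_ , d , d∈P , p) → d , p , d∈P })
    model-successors (inv r) C (d , d∈P) P⊆ =
      let (e , p , q) = P⊆ d∈P in
      ((e , q , d , d∈P , p) , (d , d∈P)) ,
      (λ { (_ , d , d∈P , p) → d , p , d∈P }) ,
      (λ { inverse d∈P → let (e , p , q) = P⊆ d∈P in e , p , q , _ , d∈P , p })

    -- For an existential, the lifted relation gives each member of `P` its own successor inside the
    -- witness `Q`.
    ext⇒⊆ : ∀ (C : Concept ℒ) {P} → ext model C P → ⟦ P ⟧ U.⊆ ext ℐ C
    ext⇒⊆ ⊤ᶜ       {P} _         d∈P = ⟦ P ⟧⊆Δ d∈P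
    ext⇒⊆ (atom A) (_ , P⊆A)     d∈P = P⊆A d∈P
    ext⇒⊆ (C ⊓ D)  (p , q)       d∈P = ext⇒⊆ C p d∈P , ext⇒⊆ D q d∈P
    ext⇒⊆ (∃[ R ]∙ C) (Q , p , q) d∈P =
      let (e , r , e∈Q) = model-step R p d∈P in e , r , ext⇒⊆ C q e∈Q

    -- The members of `P` may have different witnesses for an existential; the set of all
    -- `R`-successors in `C` serves as one witness for them all.
    ⊆⇒ext : ∀ (C : Concept ℒ) {P} → Inhabited P → ⟦ P ⟧ U.⊆ ext ℐ C → ext model C P
    ⊆⇒ext ⊤ᶜ       P∋d P⊆ = P∋d
    -- Nonemptiness is essential here: the empty set is included even in the extension of `⊥ᶜ`.
    ⊆⇒ext ⊥ᶜ       (_ , d∈P) P⊆ = P⊆ d∈P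
    ⊆⇒ext (atom A) P∋d P⊆ = P∋d , P⊆
    ⊆⇒ext (C ⊓ D)  P∋d P⊆ = ⊆⇒ext C P∋d (proj₁ ∘ P⊆) , ⊆⇒ext D P∋d (proj₂ ∘ P⊆)
    ⊆⇒ext (∃[ R ]∙ C) {P} (d , d∈P) P⊆ =
      let (e , p , q) = P⊆ d∈P in
      inj₂ (successors P R C) , model-successors R C (d , d∈P) P⊆ ,
      ⊆⇒ext C (e , q , d , d∈P , p) proj₁

    model-CI : ∀ {ci : CI ℒ} → Semantics.SatisfiesCI ℐ ci → Semantics.SatisfiesCI model ci
    model-CI {C ⊑ D} C⊆D {P} p =
      ⊆⇒ext D {P} (ext⊆Δ model C p) (λ d∈P → C⊆D (ext⇒⊆ C p d∈P))

  simulation-consistent : ∀ {ℒ 𝒜 ℐ S} {𝒪 : Ontology ℒ} → IsRoleSimulation ℒ ⟪ 𝒜 ⟫ ℐ S →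
                          ModelOfOntology ℐ 𝒪 → Consistent 𝒜 𝒪
  simulation-consistent {ℒ} {𝒜} {ℐ} {S} sim ℐ⊨𝒪 =
    model , All.tabulate (λ {α} → satisfies α) , All.map model-CI ℐ⊨𝒪
    where
      open IsRoleSimulation sim

      simulated-individual : ∃[ a ] U.Satisfiable (S (inj₁ a))
      simulated-individual = let (a , a∈𝒜) = ind-nonempty 𝒜 in a , total a∈𝒜

      -- An individual outside `𝒜` is simulated by nothing, so its set is empty and it stays outside
      -- the domain.
      open SetModel ℐ ℒ (λ a → S (inj₁ a)) (proj₂ ∘ S⊆Δ×Δ) simulated-individual

      step : ∀ (R : Role ℒ) {a b} → fact R a b ∈ᴬ 𝒜 → Step R (inj₁ a) (inj₁ b)
      step R p s with role-sim R s (fact⇒roleExt 𝒜 R p)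
      ... | e , q , t = e , q , t

      satisfies : ∀ α → α ∈ᴬ 𝒜 → Semantics.SatisfiesAssertion model α
      satisfies (concept A a) α∈𝒜 =
        total (∈-ind 𝒜 α∈𝒜 (here refl)) , λ s → atom-sim s α∈𝒜
      satisfies (role r a b) α∈𝒜 =
        (total (∈-ind 𝒜 α∈𝒜 (here refl)) , total (∈-ind 𝒜 α∈𝒜 (there (here refl)))) ,
        -- The backward half is requested only for `ELI⊥`, where the simulation also handles
        -- `inv r`.
        step (name r) α∈𝒜 , λ { inverse → step (inv r) α∈𝒜 }

  -- Disjoint unions of interpretations.

  module DisjointUnion (Ix : Set) (i₀ : Ix) (ℐ : Ix → Interpretation) where

    Point : Set
    Point = NI ⊎ Σ[ i ∈ Ix ] Object (ℐ i)

    data UnionRel (r : NR) : Point → Point → Set where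
      inside : ∀ {i d e} → rel (ℐ i) r d e → UnionRel r (inj₂ (i , d)) (inj₂ (i , e))

    -- The models may share individual names, so every element is replaced by a tagged copy and no
    -- individual denotes itself in the domain. This is harmless, as the union only has to satisfy
    -- the ontology.
    union : Interpretation
    union .Other                   = Σ[ i ∈ Ix ] Object (ℐ i)
    union .Δ (inj₁ _)              = ⊥
    union .Δ (inj₂ (i , d))        = Δ (ℐ i) d
    union .nonempty                = let (d , d∈Δ) = nonempty (ℐ i₀) in inj₂ (i₀ , d) , d∈Δ
    union .conc A (inj₁ _)         = ⊥
    union .conc A (inj₂ (i , d))   = conc (ℐ i) A d
    union .rel                     = UnionRel
    union .conc⊆Δ {d = inj₂ (i , _)} = conc⊆Δ (ℐ i)
    union .rel⊆Δ×Δ (inside {i} p)  = rel⊆Δ×Δ (ℐ i) p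

    roleExt-inside : ∀ {ℒ} (R : Role ℒ) {i d e} →
                     roleExt (ℐ i) R d e → roleExt union R (inj₂ (i , d)) (inj₂ (i , e))
    roleExt-inside (name r) p = inside p
    roleExt-inside (inv r)  p = inside p

    roleExt-outside : ∀ {ℒ} (R : Role ℒ) {i d y} → roleExt union R (inj₂ (i , d)) y →
                      ∃[ e ] (y ≡ inj₂ (i , e) × roleExt (ℐ i) R d e)
    roleExt-outside (name r) (inside p) = _ , refl , p
    roleExt-outside (inv r)  (inside p) = _ , refl , p

    ext-inside : ∀ {ℒ} (C : Concept ℒ) {i d} → ext (ℐ i) C d → ext union C (inj₂ (i , d))
    ext-inside ⊤ᶜ          p           = p
    ext-inside (atom A)    p           = p
    ext-inside (C ⊓ D)     (p , q)     = ext-inside C p , ext-inside D q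
    ext-inside (∃[ R ]∙ C) (_ , p , q) = _ , roleExt-inside R p , ext-inside C q

    ext-outside : ∀ {ℒ} (C : Concept ℒ) {i d} → ext union C (inj₂ (i , d)) → ext (ℐ i) C d
    ext-outside ⊤ᶜ          p           = p
    ext-outside (atom A)    p           = p
    ext-outside (C ⊓ D)     (p , q)     = ext-outside C p , ext-outside D q
    ext-outside (∃[ R ]∙ C) (_ , p , q) with roleExt-outside R p
    ... | _ , refl , r = _ , r , ext-outside C q

    union-model : ∀ {ℒ} {𝒪 : Ontology ℒ} → (∀ i → ModelOfOntology (ℐ i) 𝒪) →
                  ModelOfOntology union 𝒪
    union-model {𝒪 = 𝒪} ℐ⊨𝒪 = All.tabulate (λ {ci} → satisfies ci)
      where
        satisfies : ∀ ci → ci ∈ 𝒪 → Semantics.SatisfiesCI union ci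
        satisfies (C ⊑ D) ci∈𝒪 {inj₁ _}       p = ⊥-elim (ext⊆Δ union C p)
        satisfies (C ⊑ D) ci∈𝒪 {inj₂ (i , _)} p =
          ext-inside D (All.lookup (ℐ⊨𝒪 i) ci∈𝒪 (ext-outside C p))

  -- The union of the positive examples, and lifting simulations to their models.

  ∈-⨄⁻ : ∀ 𝒜s (≢[] : 𝒜s ≢ []) {α} → α ∈ᴬ ⨄ 𝒜s ≢[] → ∃[ 𝒜 ] (𝒜 ∈ 𝒜s × α ∈ᴬ 𝒜)
  ∈-⨄⁻ []       ≢[]   = ⊥-elim (≢[] refl)
  ∈-⨄⁻ (𝒜 ∷ 𝒜s) _ p = find (∈-concatMap⁻ List⁺.toList {xs = 𝒜 ∷ 𝒜s} p)

  ∈-⨄⁺ : ∀ 𝒜s (≢[] : 𝒜s ≢ []) {𝒜 α} → 𝒜 ∈ 𝒜s → α ∈ᴬ 𝒜 → α ∈ᴬ ⨄ 𝒜s ≢[]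
  ∈-⨄⁺ (_ ∷ _) _ 𝒜∈ α∈ = ∈-concatMap⁺ List⁺.toList (lose 𝒜∈ α∈)

  nonempty-list : (𝒜s : List ABox) → 𝒜s ≢ [] → ∃[ 𝒜 ] 𝒜 ∈ 𝒜s
  nonempty-list []      ≢[] = ⊥-elim (≢[] refl)
  nonempty-list (𝒜 ∷ _) _   = 𝒜 , here refl

  module _ (E : LabeledExamples) where
    open LabeledExamples E

    -- Disjointness is known only for ABoxes that differ as sets. Were `α` missing from `𝒜`, the two
    -- would differ and yet share `a`; decidability of membership turns this contradiction into a
    -- proof.
    shared-individual : ∀ {𝒜 ℬ α a} → 𝒜 ∈ E⁺ → ℬ ∈ E⁺ → a ∈ ind 𝒜 →
                        α ∈ᴬ ℬ → a ∈ indAssertion α → α ∈ᴬ 𝒜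
    shared-individual {𝒜} {ℬ} {α} 𝒜∈ ℬ∈ a∈𝒜 α∈ℬ a∈α =
      decidable-stable (α ∈ᴬ? List⁺.toList 𝒜) λ α∉𝒜 →
        disjoint (∈-++⁺ˡ 𝒜∈) (∈-++⁺ˡ ℬ∈)
          (λ 𝒜≈ℬ → α∉𝒜 (Equivalence.from 𝒜≈ℬ α∈ℬ)) (a∈𝒜 , ∈-ind ℬ α∈ℬ a∈α)

    module _ (E⁺≢[] : E⁺ ≢ []) where

      𝒜⁺ : ABox
      𝒜⁺ = ⨄ E⁺ E⁺≢[]

      -- Edges of `𝒜⁺` therefore never leave a component, so a simulation step can be repeated
      -- inside the model of that component.
      component-closed : ∀ {𝒜 α a} → 𝒜 ∈ E⁺ → a ∈ ind 𝒜 →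
                         α ∈ᴬ 𝒜⁺ → a ∈ indAssertion α → α ∈ᴬ 𝒜
      component-closed 𝒜∈ a∈𝒜 α∈𝒜⁺ a∈α =
        let (_ , ℬ∈ , α∈ℬ) = ∈-⨄⁻ E⁺ E⁺≢[] α∈𝒜⁺ in shared-individual 𝒜∈ ℬ∈ a∈𝒜 α∈ℬ a∈α

      ∈-ind-⨄⁻ : ∀ {a} → a ∈ ind 𝒜⁺ → ∃[ 𝒜 ] (𝒜 ∈ E⁺ × a ∈ ind 𝒜)
      ∈-ind-⨄⁻ a∈𝒜⁺ =
        let (_ , α∈𝒜⁺ , a∈α) = ind⇒assertion 𝒜⁺ a∈𝒜⁺
            (𝒜 , 𝒜∈ , α∈𝒜)   = ∈-⨄⁻ E⁺ E⁺≢[] α∈𝒜⁺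
        in 𝒜 , 𝒜∈ , ∈-ind 𝒜 α∈𝒜 a∈α

      module _ {ℒ} {𝒪 : Ontology ℒ} (consistent : ∀ {𝒜} → 𝒜 ∈ E⁺ → Consistent 𝒜 𝒪) where

        open DisjointUnion (∃[ 𝒜 ] 𝒜 ∈ E⁺) (nonempty-list E⁺ E⁺≢[])
                           (λ (_ , 𝒜∈) → proj₁ (consistent 𝒜∈))

        ⊨ᴬ : ∀ {𝒜} (𝒜∈ : 𝒜 ∈ E⁺) → ModelOfABox (proj₁ (consistent 𝒜∈)) 𝒜
        ⊨ᴬ 𝒜∈ = proj₁ (proj₂ (consistent 𝒜∈))

        module _ {ℬ S} (sim : IsRoleSimulation ℒ ⟪ ℬ ⟫ ⟪ 𝒜⁺ ⟫ S) where
          open IsRoleSimulation sim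

          -- The simulation `S` followed by the passage from `b` to its copies in the models of all
          -- positive examples that contain `b`.
          data Lifted : REL (Object ⟪ ℬ ⟫) Point 0ℓ where
            lifted : ∀ {x 𝒜 𝒜∈ b} → S x (inj₁ b) → b ∈ ind 𝒜 →
                     Lifted x (inj₂ ((𝒜 , 𝒜∈) , inj₁ b))

          lifted-simulation : IsRoleSimulation ℒ ⟪ ℬ ⟫ union Lifted
          lifted-simulation = record
            { S⊆Δ×Δ    = λ { (lifted {𝒜∈ = 𝒜∈} s b∈𝒜) →
                proj₁ (S⊆Δ×Δ s) , ind⊆Δ (⊨ᴬ 𝒜∈) b∈𝒜 }
            ; atom-sim = λ { (lifted {𝒜∈ = 𝒜∈} s b∈𝒜) p →
                All.lookup (⊨ᴬ 𝒜∈) (component-closed 𝒜∈ b∈𝒜 (atom-sim s p) (here refl)) }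
            ; role-sim = role-lifted
            ; total    = total-lifted
            }
            where
              role-lifted : ∀ {d₁ d₂ e₁} (R : Role ℒ) → Lifted d₁ d₂ → roleExt ⟪ ℬ ⟫ R d₁ e₁ →
                            ∃[ e₂ ] (roleExt union R d₂ e₂ × Lifted e₁ e₂)
              role-lifted R (lifted {𝒜 = 𝒜} {𝒜∈} {b} s b∈𝒜) p with role-sim R s p
              ... | inj₁ c , q , t =
                let (b∈ , c∈) = fact-ind R b c
                    Rbc∈𝒜     = component-closed 𝒜∈ b∈𝒜 (roleExt⇒fact 𝒜⁺ R q) b∈
                in _ , roleExt-inside R (fact-model (⊨ᴬ 𝒜∈) R Rbc∈𝒜) ,
                   lifted t (∈-ind 𝒜 Rbc∈𝒜 c∈)

              total-lifted : LeftTotal ⟪ ℬ ⟫ union Lifted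
              total-lifted d∈Δ with total d∈Δ
              ... | inj₁ b , s =
                let (_ , 𝒜∈ , b∈𝒜) = ∈-ind-⨄⁻ (proj₂ (S⊆Δ×Δ s)) in
                _ , lifted {𝒜∈ = 𝒜∈} s b∈𝒜

        simulated-consistent : ∀ {ℬ} → Simulation ℒ ⟪ ℬ ⟫ ⟪ 𝒜⁺ ⟫ → Consistent ℬ 𝒪
        simulated-consistent (_ , sim) =
          simulation-consistent (lifted-simulation (toRoleSimulation ℒ sim))
            (union-model λ (_ , 𝒜∈) → proj₂ (proj₂ (consistent 𝒜∈)))

  -- Refinement of candidate pairs and separating concepts.

  arcs : ∀ ℒ → Assertion → List (NI × Role ℒ × NI)
  arcs _    (concept _ _) = []
  arcs EL⊥  (role r a b)  = (a , name r , b) ∷ []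
  arcs ELI⊥ (role r a b)  = (a , name r , b) ∷ (b , inv r , a) ∷ []

  arcs-fact : ∀ {ℒ} α {R : Role ℒ} {a b} → (a , R , b) ∈ arcs ℒ α → α ≡ fact R a b
  arcs-fact {EL⊥}  (role r a b) (here refl)         = refl
  arcs-fact {ELI⊥} (role r a b) (here refl)         = refl
  arcs-fact {ELI⊥} (role r a b) (there (here refl)) = refl

  fact-arcs : ∀ {ℒ} (R : Role ℒ) {a b} → (a , R , b) ∈ arcs ℒ (fact R a b)
  fact-arcs {EL⊥}  (name r) = here refl
  fact-arcs {ELI⊥} (name r) = here refl
  fact-arcs {ELI⊥} (inv r)  = there (here refl)

  -- A finite list of everything the role condition of a simulation must match, so that the
  -- condition can be checked by traversal.
  edges : ∀ ℒ → ABox → List (NI × Role ℒ × NI)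
  edges ℒ 𝒜 = concatMap (arcs ℒ) (List⁺.toList 𝒜)

  edge⇒fact : ∀ {ℒ} 𝒜 {R : Role ℒ} {a b} → (a , R , b) ∈ edges ℒ 𝒜 → fact R a b ∈ᴬ 𝒜
  edge⇒fact {ℒ} 𝒜 p with find (∈-concatMap⁻ (arcs ℒ) {xs = List⁺.toList 𝒜} p)
  ... | α , α∈𝒜 , q with arcs-fact α q
  ... | refl = α∈𝒜

  fact⇒edge : ∀ {ℒ} 𝒜 {R : Role ℒ} {a b} → fact R a b ∈ᴬ 𝒜 → (a , R , b) ∈ edges ℒ 𝒜
  fact⇒edge {ℒ} 𝒜 {R} p = ∈-concatMap⁺ (arcs ℒ) (lose p (fact-arcs R))

  module Refinement (ℒ : Language) (𝒜 ℬ : ABox) where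

    _⊨_ _⊭_ : NI → Concept ℒ → Set
    a ⊨ C = ext ⟪ 𝒜 ⟫ C (inj₁ a)
    b ⊭ C = ¬ ext ⟪ ℬ ⟫ C (inj₁ b)

    Separable : NI → NI → Set
    Separable a b = ∃[ C ] (a ⊨ C × b ⊭ C)

    -- The conjunction of the given concepts works, with `⊤ᶜ` for the empty list. The guard `Q`
    -- singles out those `b` that have to be refuted: the successors of a fixed individual, or the
    -- individuals of `ℬ`.
    common-separator : ∀ {Q : Pred NI 0ℓ} {a} → a ∈ ind 𝒜 → ∀ {bs} →
                       All (λ b → ∃[ C ] (a ⊨ C × (Q b → b ⊭ C))) bs →
                       ∃[ C ] (a ⊨ C × All (λ b → Q b → b ⊭ C) bs)
    common-separator a∈𝒜 []                       = ⊤ᶜ , a∈𝒜 , []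
    common-separator a∈𝒜 ((C , a⊨C , b⊭C) ∷ sep) =
      let (D , a⊨D , ⊭D) = common-separator a∈𝒜 sep in
      C ⊓ D , (a⊨C , a⊨D) ,
      (λ q (b∈C , _) → b⊭C q b∈C) ∷ All.map (λ b⊭D q (_ , b∈D) → b⊭D q b∈D) ⊭D

    Candidates : Set
    Candidates = List (NI × NI)

    -- The invariant of the refinement. The second component ranges over all names; those outside
    -- `ℬ` are separated from the start.
    Refined : Candidates → Set
    Refined L = ∀ {a} → a ∈ ind 𝒜 → ∀ b → (a , b) ∈ L ⊎ Separable a b

    AtomOK : NI × NI → Assertion → Set
    AtomOK (a , b) α = ∀ {A} → α ≡ concept A a → concept A b ∈ᴬ ℬ

    EdgeOK : Candidates → NI × NI → NI × Role ℒ × NI → Set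
    EdgeOK L (a , b) (a′ , R , c) =
      a′ ≡ a → ∃[ d ] (fact R b d ∈ᴬ ℬ × (c , d) ∈ L)

    -- The local simulation conditions at `p` relative to `L`. If they hold at all pairs of `L`,
    -- then `L` induces a simulation up to left-totality.
    OK : Candidates → NI × NI → Set
    OK L p = All (AtomOK p) (List⁺.toList 𝒜) × All (EdgeOK L p) (edges ℒ 𝒜)

    check-atom : ∀ {a b α} → α ∈ᴬ 𝒜 → AtomOK (a , b) α ⊎ Separable a b
    check-atom {α = role _ _ _} _ = inj₁ λ ()
    check-atom {a} {b} {concept A a′} α∈𝒜 with a′ ≟I a | concept A b ∈ᴬ? List⁺.toList ℬ
    ... | no a′≢a  | _       = inj₁ λ { refl → ⊥-elim (a′≢a refl) }
    ... | yes _    | yes β∈ℬ = inj₁ λ { refl → β∈ℬ }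
    ... | yes refl | no β∉ℬ  = inj₂ (atom A , α∈𝒜 , β∉ℬ)

    -- The Hennessy-Milner step. If no `R`-successor `d` of `b` matches `c`, the invariant separates
    -- `c` from each of them; with `C` the conjunction of the separators, `∃[ R ]∙ C` separates `a`
    -- from `b`.
    check-edge : ∀ {L} → Refined L → ∀ {a b e} → e ∈ edges ℒ 𝒜 →
                 EdgeOK L (a , b) e ⊎ Separable a b
    check-edge {L} refined {a} {b} {a′ , R , c} e∈ with a′ ≟I a
    ... | no a′≢a  = inj₁ (⊥-elim ∘ a′≢a)
    ... | yes refl with All.decide check-successor (ind ℬ)
      where
        Rac∈𝒜 : fact R a c ∈ᴬ 𝒜
        Rac∈𝒜 = edge⇒fact 𝒜 e∈

        c∈𝒜 : c ∈ ind 𝒜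
        c∈𝒜 = ∈-ind 𝒜 Rac∈𝒜 (proj₂ (fact-ind R a c))

        check-successor : ∀ d → (∃[ C ] (c ⊨ C × (fact R b d ∈ᴬ ℬ → d ⊭ C))) ⊎
                                (fact R b d ∈ᴬ ℬ × (c , d) ∈ L)
        check-successor d with fact R b d ∈ᴬ? List⁺.toList ℬ | refined c∈𝒜 d
        -- Not a successor of `b`, so nothing has to be refuted at `d` and `⊤ᶜ` is a neutral
        -- conjunct.
        ... | no ∉ℬ  | _                     = inj₁ (⊤ᶜ , c∈𝒜 , λ ∈ℬ → ⊥-elim (∉ℬ ∈ℬ))
        ... | yes ∈ℬ | inj₁ cd∈L             = inj₂ (∈ℬ , cd∈L)
        ... | yes _  | inj₂ (C , c⊨C , d⊭C) = inj₁ (C , c⊨C , λ _ → d⊭C)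
    ... | inj₂ some = inj₁ λ _ → Any.satisfied some
    ... | inj₁ none =
      let Rac∈𝒜           = edge⇒fact 𝒜 e∈
          c∈𝒜             = ∈-ind 𝒜 Rac∈𝒜 (proj₂ (fact-ind R a c))
          (C , c⊨C , ⊭C) = common-separator c∈𝒜 none
      in inj₂ (∃[ R ]∙ C , (inj₁ c , fact⇒roleExt 𝒜 R Rac∈𝒜 , c⊨C) ,
               λ { (inj₁ d , p , d∈C) →
                   let Rbd∈ℬ = roleExt⇒fact ℬ R p
                       d∈ℬ   = ∈-ind ℬ Rbd∈ℬ (proj₂ (fact-ind R b d))
                   in All.lookup ⊭C d∈ℬ Rbd∈ℬ d∈C })

    all-or-separable : ∀ {X : Set} {P : Pred X 0ℓ} {a b} xs →
                       (∀ {x} → x ∈ xs → P x ⊎ Separable a b) →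
                       All P xs ⊎ Separable a b
    all-or-separable []       f = inj₁ []
    all-or-separable (x ∷ xs) f with f (here refl) | all-or-separable xs (f ∘ there)
    ... | inj₂ sep | _        = inj₂ sep
    ... | inj₁ _   | inj₂ sep = inj₂ sep
    ... | inj₁ px  | inj₁ pxs = inj₁ (px ∷ pxs)

    check : ∀ {L} → Refined L → ∀ ((a , b) : NI × NI) → OK L (a , b) ⊎ Separable a b
    check refined (a , b)
      with all-or-separable (List⁺.toList 𝒜) check-atom
         | all-or-separable (edges ℒ 𝒜) (check-edge refined)
    ... | inj₂ sep | _        = inj₂ sep
    ... | inj₁ _   | inj₂ sep = inj₂ sep
    ... | inj₁ ok  | inj₁ ok′ = inj₁ (ok , ok′)

    -- Each round removes all occurrences of one failing pair, so the length drops. Separators do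
    -- not refer to `L`, so pairs discarded earlier stay separated.
    refine : ∀ L → Acc _<_ (length L) → Refined L → ∃[ L′ ] (Refined L′ × All (OK L′) L′)
    refine L (acc rec) refined with All.decide (check refined) L
    ... | inj₁ ok  = L , refined , ok
    ... | inj₂ bad =
      let (p , p∈L , sep) = find bad
          kept?           = λ q → ¬? (≡-dec _≟I_ _≟I_ q p)
      in refine (filter kept? L)
                (rec (filter-notAll kept? L (lose p∈L λ p≢p → p≢p refl)))
                (λ a∈𝒜 b → remove p sep kept? (refined a∈𝒜 b))
      where
        remove : ∀ {a b} (p : NI × NI) → Separable (proj₁ p) (proj₂ p) →
                 (kept? : U.Decidable (_≢ p)) → (a , b) ∈ L ⊎ Separable a b →
                 (a , b) ∈ filter kept? L ⊎ Separable a b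
        remove p _   kept? (inj₂ sep) = inj₂ sep
        remove {a} {b} p sep kept? (inj₁ q∈L) with ≡-dec _≟I_ _≟I_ (a , b) p
        ... | yes refl = inj₂ sep
        ... | no q≢p   = inj₁ (∈-filter⁺ kept? q∈L q≢p)

    all-pairs-refined : Refined (cartesianProduct (ind 𝒜) (ind ℬ))
    all-pairs-refined a∈𝒜 b with b ∈I? ind ℬ
    ... | yes b∈ℬ = inj₁ (∈-cartesianProduct⁺ a∈𝒜 b∈ℬ)
    -- Outside the domain of `⟪ ℬ ⟫` even `⊤ᶜ` fails.
    ... | no b∉ℬ  = inj₂ (⊤ᶜ , a∈𝒜 , b∉ℬ)

    Distinguished : Set
    Distinguished = Σ[ C ∈ Concept ℒ ] (U.Satisfiable (ext ⟪ 𝒜 ⟫ C) × U.Empty (ext ⟪ ℬ ⟫ C))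

    module _ {L} (ok : All (OK L) L) where

      data Related : REL (Object ⟪ 𝒜 ⟫) (Object ⟪ ℬ ⟫) 0ℓ where
        related : ∀ {a b} → a ∈ ind 𝒜 → b ∈ ind ℬ → (a , b) ∈ L → Related (inj₁ a) (inj₁ b)

      related-simulation : (∀ {a} → a ∈ ind 𝒜 → ∃[ b ] (b ∈ ind ℬ × (a , b) ∈ L)) →
                           IsRoleSimulation ℒ ⟪ 𝒜 ⟫ ⟪ ℬ ⟫ Related
      related-simulation total = record
        { S⊆Δ×Δ    = λ { (related a∈𝒜 b∈ℬ _) → a∈𝒜 , b∈ℬ }
        ; atom-sim = λ { (related _ _ ab∈L) α∈𝒜 →
            All.lookup (proj₁ (All.lookup ok ab∈L)) α∈𝒜 refl }
        ; role-sim = role-related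
        ; total    = λ { {inj₁ a} a∈𝒜 →
            let (b , b∈ℬ , ab∈L) = total a∈𝒜 in inj₁ b , related a∈𝒜 b∈ℬ ab∈L }
        }
        where
          role-related : ∀ {d₁ d₂ e₁} (R : Role ℒ) → Related d₁ d₂ → roleExt ⟪ 𝒜 ⟫ R d₁ e₁ →
                         ∃[ e₂ ] (roleExt ⟪ ℬ ⟫ R d₂ e₂ × Related e₁ e₂)
          role-related {e₁ = inj₁ c} R (related {a} {b} _ _ ab∈L) p =
            let Rac∈𝒜 = roleExt⇒fact 𝒜 R p
                (d , Rbd∈ℬ , cd∈L) =
                  All.lookup (proj₂ (All.lookup ok ab∈L)) (fact⇒edge 𝒜 Rac∈𝒜) refl
            in inj₁ d , fact⇒roleExt ℬ R Rbd∈ℬ ,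
               related (∈-ind 𝒜 Rac∈𝒜 (proj₂ (fact-ind R a c)))
                       (∈-ind ℬ Rbd∈ℬ (proj₂ (fact-ind R b d))) cd∈L

    -- If `a` has no candidate left, one conjunction separates it from all individuals of `ℬ`.
    -- Extensions lie within the domain, so this concept is empty in `ℬ`.
    partner-or-distinguished : ∀ {L} → Refined L → ∀ {a} → a ∈ ind 𝒜 →
                               (∃[ b ] (b ∈ ind ℬ × (a , b) ∈ L)) ⊎ Distinguished
    partner-or-distinguished refined {a} a∈𝒜 with All.decide (Sum.swap ∘ refined a∈𝒜) (ind ℬ)
    ... | inj₂ some = inj₁ (find some)
    ... | inj₁ none =
      let (C , a⊨C , ⊭C) = common-separator {Q = _∈ ind ℬ} a∈𝒜
                              (All.map (λ (C , a⊨C , b⊭C) → C , a⊨C , λ _ → b⊭C) none)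
      in inj₂ (C , (inj₁ a , a⊨C) ,
               λ { (inj₁ b) b∈C → let b∈ℬ = ext⊆Δ ⟪ ℬ ⟫ C b∈C in All.lookup ⊭C b∈ℬ b∈ℬ b∈C })

    total-or-distinguished : ∀ {L} → Refined L → ∀ as → (∀ {a} → a ∈ as → a ∈ ind 𝒜) →
                             (∀ {a} → a ∈ as → ∃[ b ] (b ∈ ind ℬ × (a , b) ∈ L)) ⊎ Distinguished
    total-or-distinguished refined []       as⊆ = inj₁ λ ()
    total-or-distinguished refined (a ∷ as) as⊆
      with partner-or-distinguished refined (as⊆ (here refl))
         | total-or-distinguished refined as (as⊆ ∘ there)
    ... | inj₂ dist    | _           = inj₂ dist
    ... | inj₁ _       | inj₂ dist   = inj₂ dist
    ... | inj₁ partner | inj₁ others = inj₁ λ { (here refl) → partner ; (there a∈) → others a∈ }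

    -- Once the refinement has stopped, only left-totality can fail, and its failure at some `a`
    -- yields the concept.
    unsimulated-distinguished : ¬ Simulation ℒ ⟪ 𝒜 ⟫ ⟪ ℬ ⟫ → Distinguished
    unsimulated-distinguished ¬sim with refine _ (<-wellFounded _) all-pairs-refined
    ... | L , refined , ok with total-or-distinguished refined (ind 𝒜) (λ a∈ → a∈)
    ... | inj₂ dist  = dist
    ... | inj₁ total =
      ⊥-elim (¬sim (Related ok , fromRoleSimulation ℒ (related-simulation ok total)))

  -- The fitting ontology.

  refuting-ontology : ∀ {ℒ} ℬ 𝒜s → (∀ {𝒜} → 𝒜 ∈ 𝒜s → ¬ Simulation ℒ ⟪ 𝒜 ⟫ ⟪ ℬ ⟫) →
                      Σ[ 𝒪 ∈ Ontology ℒ ] (ModelOfOntology ⟪ ℬ ⟫ 𝒪 ×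
                                           (∀ {𝒜} → 𝒜 ∈ 𝒜s → ¬ Consistent 𝒜 𝒪))
  refuting-ontology ℬ []       ¬sim = [] , [] , λ ()
  refuting-ontology {ℒ} ℬ (𝒜 ∷ 𝒜s) ¬sim
    with Refinement.unsimulated-distinguished ℒ 𝒜 ℬ (¬sim (here refl))
       | refuting-ontology ℬ 𝒜s (¬sim ∘ there)
  ... | C , (inj₁ a , a∈C) , C-empty | 𝒪 , ℬ⊨𝒪 , inconsistent =
    -- The new inclusion holds in `⟪ ℬ ⟫`, where `C` is empty, and fails in every model of `𝒜`,
    -- where `ext-model` puts `a` into `C`.
    (C ⊑ ⊥ᶜ) ∷ 𝒪 , (λ {x} → C-empty x) ∷ ℬ⊨𝒪 , λ
      { (here refl) (𝒥 , 𝒥⊨𝒜 , C⊑⊥ ∷ _) → C⊑⊥ (ext-model 𝒥⊨𝒜 C a∈C)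
      ; (there 𝒜∈) (𝒥 , 𝒥⊨𝒜 , _ ∷ 𝒥⊨𝒪)  → inconsistent 𝒜∈ (𝒥 , 𝒥⊨𝒜 , 𝒥⊨𝒪)
      }

  ⨄-model : ∀ 𝒜s (≢[] : 𝒜s ≢ []) {𝒜} → 𝒜 ∈ 𝒜s → ModelOfABox ⟪ ⨄ 𝒜s ≢[] ⟫ 𝒜
  ⨄-model 𝒜s ≢[] {𝒜} 𝒜∈ = All.tabulate λ {α} → satisfies α
    where
      satisfies : ∀ α → α ∈ᴬ 𝒜 → Semantics.SatisfiesAssertion ⟪ ⨄ 𝒜s ≢[] ⟫ α
      satisfies (concept A a) = ∈-⨄⁺ 𝒜s ≢[] 𝒜∈
      satisfies (role r a b)  = ∈-⨄⁺ 𝒜s ≢[] 𝒜∈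

theorem1 : (sig : Signature) → let open DL sig in
    (E : LabeledExamples) → let open LabeledExamples E in
    (E⁺≢[] : E⁺ ≢ []) (ℒ : Language) →
    (∃[ 𝒪 ] Fits {ℒ} 𝒪 E) ⇔
    (∀ {𝒜} → 𝒜 ∈ E⁻ → ¬ Simulation ℒ ⟪ 𝒜 ⟫ ⟪ ⨄ E⁺ E⁺≢[] ⟫)
theorem1 sig E E⁺≢[] ℒ = mk⇔ fits⇒unsimulated unsimulated⇒fits
  where
    open DL sig
    open LabeledExamples E
    open Proof sig

    Unsimulated : Set₁
    Unsimulated = ∀ {𝒜} → 𝒜 ∈ E⁻ → ¬ Simulation ℒ ⟪ 𝒜 ⟫ ⟪ ⨄ E⁺ E⁺≢[] ⟫

    fits⇒unsimulated : ∃[ 𝒪 ] Fits {ℒ} 𝒪 E → Unsimulated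
    fits⇒unsimulated (𝒪 , consistent , inconsistent) 𝒜∈ sim =
      inconsistent 𝒜∈ (simulated-consistent E E⁺≢[] consistent sim)

    unsimulated⇒fits : Unsimulated → ∃[ 𝒪 ] Fits {ℒ} 𝒪 E
    unsimulated⇒fits ¬sim =
      let (𝒪 , 𝒜⁺⊨𝒪 , inconsistent) = refuting-ontology (⨄ E⁺ E⁺≢[]) E⁻ ¬sim in
      -- The union itself, as an interpretation, is the common model for every positive example.
      𝒪 , (λ 𝒜∈ → ⟪ ⨄ E⁺ E⁺≢[] ⟫ , ⨄-model E⁺ E⁺≢[] 𝒜∈ , 𝒜⁺⊨𝒪) , inconsistent
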